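{- The derivability problem for the multiplicative fragment $\mathcal{M}^{\mathrm{mult}}_{2015}$ of Morrill's calculus with stoups defined below is algorithmically undecidable.
   Context: Formulae are built from a countable set of variables and the constant $\mathbf{1}$ by the binary connectives $\backslash$, $/$, $\cdot$ (and, in the full calculus, $\wedge,\vee$) and the unary connectives $\langle\rangle$, $[]^{ -1}$ and $!$. A stoup is a finite multiset of formulae ($\varnothing$ empty). A tree term is a formula or $[\Xi]$ with $\Xi$ a meta-formula; a meta-formula is $\zeta;\Gamma$ with $\zeta$ a stoup and $\Gamma$ a finite linearly ordered sequence of tree terms (empty sequence $\Lambda$); $\varnothing;\Gamma$ is written $\Gamma$. Comma denotes concatenation of sequences and multiset union of stoups; $\zeta,A$ adds a copy of $A$. A sequent is $\Xi\to C$. $\Xi(\Theta)$ denotes a meta-formula with a designated occurrence of a meta-formula $\Theta$ which is $\Xi$ itself or the content of some bracket $[\Theta]$ at any depth; $\Xi(\Theta')$ is the result of replacement. The calculus $\mathcal{M}^{\mathrm{mult}}_{2015}$ uses formulae without $\wedge,\vee$ and has: axioms $A\to A$, $\Lambda\to\mathbf1$; ($/L$) from $\zeta_1;\Gamma\to B$ and $\Xi(\zeta_2;\Delta_1,C,\Delta_2)\to D$ infer $\Xi(\zeta_1,\zeta_2;\Delta_1,C/B,\Gamma,\Delta_2)\to D$; ($/R$) from $\zeta;\Gamma,B\to C$ infer $\zeta;\Gamma\to C/B$; ($\backslash L$) from $\zeta_1;\Gamma\to A$ and $\Xi(\zeta_2;\Delta_1,C,\Delta_2)\to D$ infer $\Xi(\zeta_1,\zeta_2;\Delta_1,\Gamma,A\backslash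 C,\Delta_2)\to D$; ($\backslash R$) from $\zeta;A,\Gamma\to C$ infer $\zeta;\Gamma\to A\backslash C$; ($\cdot L$) from $\Xi(\zeta;\Delta_1,A,B,\Delta_2)\to D$ infer $\Xi(\zeta;\Delta_1,A\cdot B,\Delta_2)\to D$; ($\cdot R$) from $\zeta_1;\Delta\to A$ and $\zeta_2;\Gamma\to B$ infer $\zeta_1,\zeta_2;\Delta,\Gamma\to A\cdot B$; ($\mathbf1L$) from $\Xi(\zeta;\Delta_1,\Delta_2)\to A$ infer $\Xi(\zeta;\Delta_1,\mathbf1,\Delta_2)\to A$; ($[]^{ -1}L$) from $\Xi(\zeta;\Delta_1,A,\Delta_2)\to B$ infer $\Xi(\zeta;\Delta_1,[[]^{ -1}A],\Delta_2)\to B$; ($[]^{ -1}R$) from $[\Xi]\to A$ infer $\Xi\to[]^{ -1}A$; ($\langle\rangle L$) from $\Xi(\zeta;\Delta_1,[A],\Delta_2)\to B$ infer $\Xi(\zeta;\Delta_1,\langle\rangle A,\Delta_2)\to B$; ($\langle\rangle R$) from $\Xi\to A$ infer $[\Xi]\to\langle\rangle A$; ($!L$) from $\Xi(\zeta,A;\Gamma_1,\Gamma_2)\to B$ infer $\Xi(\zeta;\Gamma_1,!A,\Gamma_2)\to B$; ($!P$) from $\Xi(\zeta;\Gamma_1,A,\Gamma_2)\to B$ infer $\Xi(\zeta,A;\Gamma_1,\Gamma_2)\to B$; ($!R$) from $\zeta;\Lambda\to B$ infer $\zeta;\Lambda\to!B$; ($!C$) from $\Xi(\zeta_1,\zeta_2;\Gamma_1,[\zeta_2;\Gamma_2],\Gamma_3)\to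 B$ infer $\Xi(\zeta_1,\zeta_2;\Gamma_1,\Gamma_2,\Gamma_3)\to B$, provided $\zeta_2\neq\varnothing$. Here $A,B,C,D$ are formulae, $\Gamma,\Delta,\Delta_i,\Gamma_i$ sequences of tree terms, $\zeta,\zeta_i$ stoups. Cut is not a rule. -}

module Defs where

open import Data.Bool using (Bool; true; false)
open import Data.Fin using (Fin)
open import Data.List using (List; []; _∷_; _++_; [_]; replicate; map; concatMap)
open import Data.List.Relation.Binary.Permutation.Propositional using (_↭_)
open import Data.List.Relation.Binary.Pointwise using (Pointwise)
open import Data.Nat using (ℕ)
open import Data.Product using (Σ-syntax; _×_)
open import Relation.Binary.PropositionalEquality using (_≡_; _≢_)
open import Relation.Nullary using (¬_)

infixl 8 _/_
infixr 8 _∖_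
infixr 9 _·_
infix 10 ⟨⟩_ []⁻¹_ !_

data Formula : Set where
  var   : ℕ → Formula
  𝟏     : Formula
  _∖_   : Formula → Formula → Formula
  _/_   : Formula → Formula → Formula
  _·_   : Formula → Formula → Formula
  ⟨⟩_   : Formula → Formula
  []⁻¹_ : Formula → Formula
  !_    : Formula → Formula

-- Stoups are finite multisets: lists here, identified up to permutation
-- by _≈_ below.
Stoup : Set
Stoup = List Formula

infix 4 _⨾_

mutual
  data TreeTerm : Set where
    fm : Formula → TreeTerm
    br : Meta → TreeTerm

  data Meta : Set where
    _⨾_ : Stoup → List TreeTerm → Meta

infix 4 _≈_ _≈ᵗ_

-- Equality of meta-formulae when all stoups, at every depth, are read as
-- multisets.
mutual
  data _≈ᵗ_ : TreeTerm → TreeTerm → Set where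
    fm : ∀ {A} → fm A ≈ᵗ fm A
    br : ∀ {Ξ Ξ′} → Ξ ≈ Ξ′ → br Ξ ≈ᵗ br Ξ′

  data _≈_ : Meta → Meta → Set where
    _⨾_ : ∀ {ζ ζ′ Γ Γ′} → ζ ↭ ζ′ → Pointwise _≈ᵗ_ Γ Γ′ → (ζ ⨾ Γ) ≈ (ζ′ ⨾ Γ′)

-- One-hole contexts Ξ( ): the hole is the whole meta-formula, or lies in the
-- bracketed tree term between the two sequences.
data Context : Set where
  □      : Context
  inside : Stoup → List TreeTerm → Context → List TreeTerm → Context

infix 5 _⟪_⟫

_⟪_⟫ : Context → Meta → Meta
□                 ⟪ Θ ⟫ = Θ
inside ζ Γ₁ Ξ Γ₂ ⟪ Θ ⟫ = ζ ⨾ Γ₁ ++ br (Ξ ⟪ Θ ⟫) ∷ Γ₂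

infix 3 _⇒_

data Sequent : Set where
  _⇒_ : Meta → Formula → Sequent

infix 2 ⊢_

data ⊢_ : Sequent → Set where
  -- Not an inference step: it makes derivability respect the reading of
  -- stoups as multisets.
  conv : ∀ {Ξ Ξ′ C} → Ξ ≈ Ξ′ → ⊢ Ξ ⇒ C → ⊢ Ξ′ ⇒ C

  ax   : ∀ {A} → ⊢ [] ⨾ [ fm A ] ⇒ A
  𝟏R   : ⊢ [] ⨾ [] ⇒ 𝟏
  /L   : ∀ Ξ {ζ₁ ζ₂ Γ Δ₁ Δ₂ B C D} →
         ⊢ ζ₁ ⨾ Γ ⇒ B →
         ⊢ Ξ ⟪ ζ₂ ⨾ Δ₁ ++ fm C ∷ Δ₂ ⟫ ⇒ D →
         ⊢ Ξ ⟪ ζ₁ ++ ζ₂ ⨾ Δ₁ ++ fm (C / B) ∷ Γ ++ Δ₂ ⟫ ⇒ D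
  /R   : ∀ {ζ Γ B C} →
         ⊢ ζ ⨾ Γ ++ [ fm B ] ⇒ C →
         ⊢ ζ ⨾ Γ ⇒ C / B
  ∖L   : ∀ Ξ {ζ₁ ζ₂ Γ Δ₁ Δ₂ A C D} →
         ⊢ ζ₁ ⨾ Γ ⇒ A →
         ⊢ Ξ ⟪ ζ₂ ⨾ Δ₁ ++ fm C ∷ Δ₂ ⟫ ⇒ D →
         ⊢ Ξ ⟪ ζ₁ ++ ζ₂ ⨾ Δ₁ ++ Γ ++ fm (A ∖ C) ∷ Δ₂ ⟫ ⇒ D
  ∖R   : ∀ {ζ Γ A C} →
         ⊢ ζ ⨾ fm A ∷ Γ ⇒ C →
         ⊢ ζ ⨾ Γ ⇒ A ∖ C
  ·L   : ∀ Ξ {ζ Δ₁ Δ₂ A B D} →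
         ⊢ Ξ ⟪ ζ ⨾ Δ₁ ++ fm A ∷ fm B ∷ Δ₂ ⟫ ⇒ D →
         ⊢ Ξ ⟪ ζ ⨾ Δ₁ ++ fm (A · B) ∷ Δ₂ ⟫ ⇒ D
  ·R   : ∀ {ζ₁ ζ₂ Δ Γ A B} →
         ⊢ ζ₁ ⨾ Δ ⇒ A →
         ⊢ ζ₂ ⨾ Γ ⇒ B →
         ⊢ ζ₁ ++ ζ₂ ⨾ Δ ++ Γ ⇒ A · B
  𝟏L   : ∀ Ξ {ζ Δ₁ Δ₂ A} →
         ⊢ Ξ ⟪ ζ ⨾ Δ₁ ++ Δ₂ ⟫ ⇒ A →
         ⊢ Ξ ⟪ ζ ⨾ Δ₁ ++ fm 𝟏 ∷ Δ₂ ⟫ ⇒ A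
  []⁻¹L : ∀ Ξ {ζ Δ₁ Δ₂ A B} →
         ⊢ Ξ ⟪ ζ ⨾ Δ₁ ++ fm A ∷ Δ₂ ⟫ ⇒ B →
         ⊢ Ξ ⟪ ζ ⨾ Δ₁ ++ br ([] ⨾ [ fm ([]⁻¹ A) ]) ∷ Δ₂ ⟫ ⇒ B
  []⁻¹R : ∀ {Ξ A} →
         ⊢ [] ⨾ [ br Ξ ] ⇒ A →
         ⊢ Ξ ⇒ []⁻¹ A
  ⟨⟩L  : ∀ Ξ {ζ Δ₁ Δ₂ A B} →
         ⊢ Ξ ⟪ ζ ⨾ Δ₁ ++ br ([] ⨾ [ fm A ]) ∷ Δ₂ ⟫ ⇒ B →
         ⊢ Ξ ⟪ ζ ⨾ Δ₁ ++ fm (⟨⟩ A) ∷ Δ₂ ⟫ ⇒ B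
  ⟨⟩R  : ∀ {Ξ A} →
         ⊢ Ξ ⇒ A →
         ⊢ [] ⨾ [ br Ξ ] ⇒ ⟨⟩ A
  !L   : ∀ Ξ {ζ Γ₁ Γ₂ A B} →
         ⊢ Ξ ⟪ ζ ++ [ A ] ⨾ Γ₁ ++ Γ₂ ⟫ ⇒ B →
         ⊢ Ξ ⟪ ζ ⨾ Γ₁ ++ fm (! A) ∷ Γ₂ ⟫ ⇒ B
  !P   : ∀ Ξ {ζ Γ₁ Γ₂ A B} →
         ⊢ Ξ ⟪ ζ ⨾ Γ₁ ++ fm A ∷ Γ₂ ⟫ ⇒ B →
         ⊢ Ξ ⟪ ζ ++ [ A ] ⨾ Γ₁ ++ Γ₂ ⟫ ⇒ B
  !R   : ∀ {ζ B} →
         ⊢ ζ ⨾ [] ⇒ B →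
         ⊢ ζ ⨾ [] ⇒ ! B
  !C   : ∀ Ξ {ζ₁ ζ₂ Γ₁ Γ₂ Γ₃ B} → ζ₂ ≢ [] →
         ⊢ Ξ ⟪ ζ₁ ++ ζ₂ ⨾ Γ₁ ++ br (ζ₂ ⨾ Γ₂) ∷ Γ₃ ⟫ ⇒ B →
         ⊢ Ξ ⟪ ζ₁ ++ ζ₂ ⨾ Γ₁ ++ Γ₂ ++ Γ₃ ⟫ ⇒ B

-- Sequents are presented to machines as words over this alphabet. Formulae
-- are in Polish notation, the variable with index n being x followed
-- by n strokes; hence formulae are self-delimiting, commas are superfluous,
-- and the encoding is injective.

data Symbol : Set where
  x′ stroke′ 𝟏′ ∖′ /′ ·′ ⟨⟩′ []⁻¹′ !′ : Symbol
  open′ close′ semicolon′ arrow′       : Symbol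

Word : Set
Word = List Symbol

encodeFormula : Formula → Word
encodeFormula (var n)  = x′ ∷ replicate n stroke′
encodeFormula 𝟏        = [ 𝟏′ ]
encodeFormula (A ∖ B)  = ∖′ ∷ encodeFormula A ++ encodeFormula B
encodeFormula (A / B)  = /′ ∷ encodeFormula A ++ encodeFormula B
encodeFormula (A · B)  = ·′ ∷ encodeFormula A ++ encodeFormula B
encodeFormula (⟨⟩ A)   = ⟨⟩′ ∷ encodeFormula A
encodeFormula ([]⁻¹ A) = []⁻¹′ ∷ encodeFormula A
encodeFormula (! A)    = !′ ∷ encodeFormula A

encodeStoup : Stoup → Word
encodeStoup = concatMap encodeFormula

mutual
  encodeTreeTerm : TreeTerm → Word
  encodeTreeTerm (fm A) = encodeFormula A
  encodeTreeTerm (br Ξ) = open′ ∷ encodeMeta Ξ ++ [ close′ ]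

  encodeTreeTerms : List TreeTerm → Word
  encodeTreeTerms []      = []
  encodeTreeTerms (t ∷ Γ) = encodeTreeTerm t ++ encodeTreeTerms Γ

  encodeMeta : Meta → Word
  encodeMeta (ζ ⨾ Γ) = encodeStoup ζ ++ semicolon′ ∷ encodeTreeTerms Γ

encode : Sequent → Word
encode (Ξ ⇒ C) = encodeMeta Ξ ++ arrow′ ∷ encodeFormula C

data Cell (k : ℕ) : Set where
  blank : Cell k
  input : Symbol → Cell k
  aux   : Fin k → Cell k

data Direction : Set where
  left right : Direction

-- halt true is acceptance, halt false is rejection.
data Action (n k : ℕ) : Set where
  halt : Bool → Action n k
  go   : Fin n → Cell k → Direction → Action n k

-- Deterministic, with one two-way infinite tape.
record TuringMachine : Set where
  field
    #states : ℕ
    #aux    : ℕ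
    start   : Fin #states
    δ       : Fin #states → Cell #aux → Action #states #aux

-- The visited part of the tape: cells left of the head (nearest first), the
-- scanned cell, cells right of the head (nearest first). All other cells are
-- blank.
record Tape (k : ℕ) : Set where
  constructor tape
  field
    before  : List (Cell k)
    scanned : Cell k
    after   : List (Cell k)

writeMove : ∀ {k} → Cell k → Direction → Tape k → Tape k
writeMove c left  (tape []       _ rs)       = tape [] blank (c ∷ rs)
writeMove c left  (tape (l ∷ ls) _ rs)       = tape ls l (c ∷ rs)
writeMove c right (tape ls       _ [])       = tape (c ∷ ls) blank []
writeMove c right (tape ls       _ (r ∷ rs)) = tape (c ∷ ls) r rs

initialTape : ∀ {k} → Word → Tape k
initialTape []      = tape [] blank []
initialTape (a ∷ w) = tape [] (input a) (map input w)

module _ (M : TuringMachine) where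
  open TuringMachine M

  data HaltsFrom (b : Bool) (q : Fin #states) (t : Tape #aux) : Set where
    stop : δ q (Tape.scanned t) ≡ halt b → HaltsFrom b q t
    step : ∀ {q′ c d} → δ q (Tape.scanned t) ≡ go q′ c d →
           HaltsFrom b q′ (writeMove c d t) → HaltsFrom b q t

  Accepts Rejects : Word → Set
  Accepts w = HaltsFrom true  start (initialTape w)
  Rejects w = HaltsFrom false start (initialTape w)

-- As machines are deterministic, no word is both accepted and rejected, so
-- the converse implications hold classically. Omitting them makes the failure
-- of AlgorithmicallyDecidable a constructively stronger claim.
AlgorithmicallyDecidable : (Sequent → Set) → Set
AlgorithmicallyDecidable P =
  Σ[ M ∈ TuringMachine ] (∀ S →
    (P S → Accepts M (encode S)) × (¬ P S → Rejects M (encode S)))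

{-# OPTIONS --safe #-}
module Submission where

-- Given a machine M, there is a sequent S derivable exactly when M rejects the
-- encoding of S, so M does not decide derivability.
--
-- A word w of letters stands for the sequent ζ ⨾ w ⇒ s with a fixed stoup ζ, and a
-- rule taking u X v to u′ X v′ is the stoup formula s / (u · (u′ ∖ (s / v′)) · v),
-- which sees both ends of the word. A Turing machine configuration cut open
-- at its head evolves by such rules.
--
-- Self-reference is a quine. The stoup consists of a part encoded by a word P (quotation)
-- and of one further rule, recite, that appends the letters quoting P. As the
-- encoding of recite is P translated symbol by symbol between two constants, the
-- rules can write the encoding of the whole sequent on M's tape from right to left,
-- reciting P three times: recite itself occurs twice in S, once to be used and
-- once in the formula that disposes of it.
--
-- Conversely, the calculus is sound for the powerset of the free monoid, with s
-- read as the set of words from which M can only be found to reject.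

open import Data.Bool using (true; false)
open import Data.Fin using (Fin; #_; toℕ)
open import Data.Fin.Properties using (toℕ-injective)
open import Data.List using (List; []; _∷_; _++_; _∷ʳ_; [_]; map; concatMap; foldr; lookup; reverse; allFin; cartesianProductWith; initLast; _∷ʳ′_)
open import Data.List.Membership.Propositional using (_∈_)
open import Data.List.Membership.Propositional.Properties using (∈-∃++; ∈-lookup; ∈-allFin; ∈-map⁺; ∈-++⁺ˡ; ∈-++⁺ʳ; ∈-concatMap⁺; ∈-cartesianProductWith⁺)
open import Data.List.Properties using (++-assoc; ++-identityʳ; ∷ʳ-++; ∷ʳ-injective; ∷ʳ-injectiveˡ; ∷ʳ-injectiveʳ; ∷-injectiveˡ; ∷-injectiveʳ; map-++; map-∘; concatMap-++; concatMap-pure; unfold-reverse)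
open import Data.List.Relation.Binary.Permutation.Propositional using (_↭_; ↭-refl; ↭-sym; ↭-trans; prep)
open import Data.List.Relation.Binary.Permutation.Propositional.Properties using (All-resp-↭; shift; ∷↭∷ʳ)
open import Data.List.Relation.Binary.Pointwise using (Pointwise; []; _∷_)
open import Data.List.Relation.Unary.All using (All; []; _∷_; universal)
import Data.List.Relation.Unary.All as All
import Data.List.Relation.Unary.All.Properties as All
open import Data.List.Relation.Unary.Any as Any using (here; there)
open import Data.List.Relation.Unary.Any.Properties using (lookup-index)
open import Data.List.Reverse using (Reverse; []; _∶_∶ʳ_; reverseView)
open import Data.Maybe using (Maybe; nothing; just)
open import Data.Nat using (ℕ; zero; suc)
open import Data.Product using (Σ-syntax; ∃₂; _×_; _,_; proj₁; proj₂)
open import Level using (0ℓ)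
open import Relation.Binary.PropositionalEquality using (_≡_; refl; sym; trans; cong; cong₂; subst; subst₂; setoid; module ≡-Reasoning)
open import Relation.Nullary using (¬_)
open import Relation.Unary using (Pred; _⊆_)
open import Defs

-- Soundness for the powerset of a free monoid.

module Semantics {L : Set} (V : ℕ → Pred (List L) 0ℓ) where

  infixr 6 _⊗_

  _⊗_ : Pred (List L) 0ℓ → Pred (List L) 0ℓ → Pred (List L) 0ℓ
  (P ⊗ Q) w = ∃₂ λ u v → w ≡ u ++ v × P u × Q v

  -- Brackets are erased, and !A holds of at most the empty word; thus contraction is
  -- sound although the bracket that it creates is ignored.
  ⟦_⟧ : Formula → Pred (List L) 0ℓ
  ⟦ var n ⟧    = V n
  ⟦ 𝟏 ⟧      w = w ≡ []
  ⟦ A ∖ C ⟧  w = ∀ {v} → ⟦ A ⟧ v → ⟦ C ⟧ (v ++ w)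
  ⟦ C / B ⟧  w = ∀ {v} → ⟦ B ⟧ v → ⟦ C ⟧ (w ++ v)
  ⟦ A · B ⟧    = ⟦ A ⟧ ⊗ ⟦ B ⟧
  ⟦ ⟨⟩ A ⟧     = ⟦ A ⟧
  ⟦ []⁻¹ A ⟧   = ⟦ A ⟧
  ⟦ ! A ⟧    w = w ≡ [] × ⟦ A ⟧ []

  Valid : Formula → Set
  Valid A = ⟦ A ⟧ []

  mutual
    ⟦_⟧ᵗ : TreeTerm → Pred (List L) 0ℓ
    ⟦ fm A ⟧ᵗ = ⟦ A ⟧
    ⟦ br Ξ ⟧ᵗ = ⟦ Ξ ⟧ᵐ

    ⟦_⟧* : List TreeTerm → Pred (List L) 0ℓ
    ⟦ [] ⟧*    w = w ≡ []
    ⟦ t ∷ Γ ⟧*   = ⟦ t ⟧ᵗ ⊗ ⟦ Γ ⟧*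

    -- A stoup contributes no letters: its formulae only have to hold of the empty word, so their
    -- order and multiplicity do not matter.
    ⟦_⟧ᵐ : Meta → Pred (List L) 0ℓ
    ⟦ ζ ⨾ Γ ⟧ᵐ w = All Valid ζ × ⟦ Γ ⟧* w

  single : ∀ {P} → P ⊆ P ⊗ ⟦ [] ⟧*
  single {x = w} p = w , [] , sym (++-identityʳ w) , p , refl

  unsingle : ∀ {P} → P ⊗ ⟦ [] ⟧* ⊆ P
  unsingle {P} (w , .[] , refl , p , refl) = subst P (sym (++-identityʳ w)) p

  split : ∀ Γ {Δ} → ⟦ Γ ++ Δ ⟧* ⊆ ⟦ Γ ⟧* ⊗ ⟦ Δ ⟧*
  split []      {x = w} p = [] , w , refl , refl , p
  split (t ∷ Γ) (u , _ , refl , p , q) with split Γ q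
  ... | v , w , refl , q₁ , q₂ = u ++ v , w , sym (++-assoc u v w) , (u , v , refl , p , q₁) , q₂

  join : ∀ Γ {Δ} → ⟦ Γ ⟧* ⊗ ⟦ Δ ⟧* ⊆ ⟦ Γ ++ Δ ⟧*
  join []      (.[] , w , refl , refl , q) = q
  join (t ∷ Γ) (_ , w , refl , (u , v , refl , p , q₁) , q₂) =
    u , v ++ w , ++-assoc u v w , p , join Γ (v , w , refl , q₁ , q₂)

  replace : ∀ Γ Γ′ {Δ₁ Δ₂} → ⟦ Γ ⟧* ⊆ ⟦ Γ′ ⟧* → ⟦ Δ₁ ++ Γ ++ Δ₂ ⟧* ⊆ ⟦ Δ₁ ++ Γ′ ++ Δ₂ ⟧*
  replace Γ Γ′ {Δ₁} f p with split Δ₁ p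
  ... | u , _ , refl , p₁ , p₂ with split Γ p₂
  ...   | v , w , refl , q , p₃ = join Δ₁ (u , _ , refl , p₁ , join Γ′ (v , w , refl , f q , p₃))

  replaceᵐ : ∀ Γ Γ′ {ζ Δ₁ Δ₂} → ⟦ Γ ⟧* ⊆ ⟦ Γ′ ⟧* → ⟦ ζ ⨾ Δ₁ ++ Γ ++ Δ₂ ⟧ᵐ ⊆ ⟦ ζ ⨾ Δ₁ ++ Γ′ ++ Δ₂ ⟧ᵐ
  replaceᵐ Γ Γ′ {ζ} {Δ₁} f (vs , p) = vs , replace Γ Γ′ {Δ₁} f p

  plug : ∀ Ξ {Θ Θ′} → ⟦ Θ ⟧ᵐ ⊆ ⟦ Θ′ ⟧ᵐ → ⟦ Ξ ⟪ Θ ⟫ ⟧ᵐ ⊆ ⟦ Ξ ⟪ Θ′ ⟫ ⟧ᵐ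
  plug □                 f p = f p
  plug (inside ζ Γ₁ Ξ Γ₂) {Θ} {Θ′} f =
    replaceᵐ [ br (Ξ ⟪ Θ ⟫) ] [ br (Ξ ⟪ Θ′ ⟫) ] {ζ} {Γ₁} {Γ₂}
      λ (u , v , e , p , q) → u , v , e , plug Ξ f p , q

  mutual
    ≈ᵗ-⊇ : ∀ {s t} → s ≈ᵗ t → ⟦ t ⟧ᵗ ⊆ ⟦ s ⟧ᵗ
    ≈ᵗ-⊇ fm     p = p
    ≈ᵗ-⊇ (br e) p = ≈-⊇ e p

    ≈*-⊇ : ∀ {Γ Δ} → Pointwise _≈ᵗ_ Γ Δ → ⟦ Δ ⟧* ⊆ ⟦ Γ ⟧*
    ≈*-⊇ []       p = p
    ≈*-⊇ (e ∷ es) (u , v , eq , p , q) = u , v , eq , ≈ᵗ-⊇ e p , ≈*-⊇ es q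

    ≈-⊇ : ∀ {Ξ Ξ′} → Ξ ≈ Ξ′ → ⟦ Ξ′ ⟧ᵐ ⊆ ⟦ Ξ ⟧ᵐ
    ≈-⊇ (ζ↭ζ′ ⨾ es) (vs , p) = All-resp-↭ (↭-sym ζ↭ζ′) vs , ≈*-⊇ es p

  -- For a left rule it suffices that the antecedent of the conclusion, at the hole, is included in
  -- that of the main premise; `plug` carries the inclusion through the context.
  sound : ∀ {Ξ C} → ⊢ Ξ ⇒ C → ⟦ Ξ ⟧ᵐ ⊆ ⟦ C ⟧
  sound (conv e d) p = sound d (≈-⊇ e p)
  sound ax (_ , p) = unsingle p
  sound 𝟏R (_ , p) = p
  sound (/L Ξ {ζ₁} {ζ₂} {Γ} {Δ₁} {Δ₂} {B} {C} d e) p = sound e (plug Ξ f p)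
    where
    f : ⟦ ζ₁ ++ ζ₂ ⨾ Δ₁ ++ fm (C / B) ∷ Γ ++ Δ₂ ⟧ᵐ ⊆ ⟦ ζ₂ ⨾ Δ₁ ++ fm C ∷ Δ₂ ⟧ᵐ
    f (vs , q) with All.++⁻ ζ₁ vs
    ... | vs₁ , vs₂ = vs₂ , replace (fm (C / B) ∷ Γ) [ fm C ] {Δ₁}
      (λ { (u , v , refl , r , s) → single (r (sound d (vs₁ , s))) }) q
  sound (/R {Γ = Γ} d) (vs , p) {v} q = sound d (vs , join Γ (_ , v , refl , p , single q))
  sound (∖L Ξ {ζ₁} {ζ₂} {Γ} {Δ₁} {Δ₂} {A} {C} d e) p = sound e (plug Ξ f p)
    where
    f : ⟦ ζ₁ ++ ζ₂ ⨾ Δ₁ ++ Γ ++ fm (A ∖ C) ∷ Δ₂ ⟧ᵐ ⊆ ⟦ ζ₂ ⨾ Δ₁ ++ fm C ∷ Δ₂ ⟧ᵐ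
    f (vs , q) with All.++⁻ ζ₁ vs
    ... | vs₁ , vs₂ rewrite sym (++-assoc Γ [ fm (A ∖ C) ] Δ₂) =
      vs₂ , replace (Γ ++ [ fm (A ∖ C) ]) [ fm C ] {Δ₁} g q
      where
      g : ⟦ Γ ++ [ fm (A ∖ C) ] ⟧* ⊆ ⟦ [ fm C ] ⟧*
      g r with split Γ r
      ... | u , v , refl , r₁ , r₂ = single (unsingle r₂ (sound d (vs₁ , r₁)))
  sound (∖R d) (vs , p) q = sound d (vs , _ , _ , refl , q , p)
  sound (·L Ξ {ζ} {Δ₁} {Δ₂} {A} {B} d) p =
    sound d (plug Ξ (replaceᵐ [ fm (A · B) ] (fm A ∷ fm B ∷ []) {ζ} {Δ₁} {Δ₂} f) p)
    where
    f : ⟦ [ fm (A · B) ] ⟧* ⊆ ⟦ fm A ∷ fm B ∷ [] ⟧*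
    f q with unsingle q
    ... | u , v , refl , r , s = u , v , refl , r , single s
  sound (·R {ζ₁} {Δ = Δ} d e) (vs , p) with All.++⁻ ζ₁ vs | split Δ p
  ... | vs₁ , vs₂ | u , v , refl , p₁ , p₂ = u , v , refl , sound d (vs₁ , p₁) , sound e (vs₂ , p₂)
  sound (𝟏L Ξ {ζ} {Δ₁} {Δ₂} d) p =
    sound d (plug Ξ (replaceᵐ [ fm 𝟏 ] [] {ζ} {Δ₁} {Δ₂} (λ q → unsingle q)) p)
  sound ([]⁻¹L Ξ {ζ} {Δ₁} {Δ₂} {A} d) p =
    sound d (plug Ξ (replaceᵐ [ br ([] ⨾ [ fm ([]⁻¹ A) ]) ] [ fm A ] {ζ} {Δ₁} {Δ₂} f) p)
    where
    f : ⟦ [ br ([] ⨾ [ fm ([]⁻¹ A) ]) ] ⟧* ⊆ ⟦ [ fm A ] ⟧*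
    f (u , v , e , (_ , q) , r) = u , v , e , unsingle q , r
  sound ([]⁻¹R d) p = sound d ([] , single p)
  sound (⟨⟩L Ξ {ζ} {Δ₁} {Δ₂} {A} d) p =
    sound d (plug Ξ (replaceᵐ [ fm (⟨⟩ A) ] [ br ([] ⨾ [ fm A ]) ] {ζ} {Δ₁} {Δ₂} f) p)
    where
    f : ⟦ [ fm (⟨⟩ A) ] ⟧* ⊆ ⟦ [ br ([] ⨾ [ fm A ]) ] ⟧*
    f (u , v , e , q , r) = u , v , e , ([] , single q) , r
  sound (⟨⟩R d) (_ , p) = sound d (unsingle p)
  sound (!L Ξ {ζ} {Γ₁} {Γ₂} {A} d) p = sound d (plug Ξ f p)
    where
    f : ⟦ ζ ⨾ Γ₁ ++ fm (! A) ∷ Γ₂ ⟧ᵐ ⊆ ⟦ ζ ++ [ A ] ⨾ Γ₁ ++ Γ₂ ⟧ᵐ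
    f (vs , q) with split Γ₁ q
    ... | u , _ , refl , q₁ , (.[] , w , refl , (refl , v) , q₂) =
      All.++⁺ vs (v ∷ []) , join Γ₁ (u , w , refl , q₁ , q₂)
  sound (!P Ξ {ζ} {Γ₁} {Γ₂} {A} d) p = sound d (plug Ξ f p)
    where
    f : ⟦ ζ ++ [ A ] ⨾ Γ₁ ++ Γ₂ ⟧ᵐ ⊆ ⟦ ζ ⨾ Γ₁ ++ fm A ∷ Γ₂ ⟧ᵐ
    f (vs , q) with All.++⁻ ζ vs
    ... | vs′ , v ∷ [] = vs′ , replace [] [ fm A ] {Γ₁} (λ { refl → single v }) q
  sound (!R d) (vs , p) = p , sound d (vs , refl)
  sound (!C Ξ {ζ₁} {ζ₂} {Γ₁} {Γ₂} {Γ₃} _ d) p = sound d (plug Ξ f p)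
    where
    f : ⟦ ζ₁ ++ ζ₂ ⨾ Γ₁ ++ Γ₂ ++ Γ₃ ⟧ᵐ ⊆ ⟦ ζ₁ ++ ζ₂ ⨾ Γ₁ ++ br (ζ₂ ⨾ Γ₂) ∷ Γ₃ ⟧ᵐ
    -- The formulae of `ζ₂` hold of the empty word outside the new bracket, hence also inside it.
    f (vs , q) with All.++⁻ ζ₁ vs
    ... | _ , vs₂ = vs , replace Γ₂ [ br (ζ₂ ⨾ Γ₂) ] {Γ₁} (λ r → single (vs₂ , r)) q

-- Reusing and discarding stoup formulae.

mutual
  ≈ᵗ-refl : ∀ {t} → t ≈ᵗ t
  ≈ᵗ-refl {fm A} = fm
  ≈ᵗ-refl {br Ξ} = br ≈-refl

  ≈*-refl : ∀ {Γ} → Pointwise _≈ᵗ_ Γ Γ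
  ≈*-refl {[]}    = []
  ≈*-refl {t ∷ Γ} = ≈ᵗ-refl ∷ ≈*-refl

  ≈-refl : ∀ {Ξ} → Ξ ≈ Ξ
  ≈-refl {ζ ⨾ Γ} = ↭-refl ⨾ ≈*-refl

permute : ∀ {ζ ζ′ Γ C} → ζ ↭ ζ′ → ⊢ ζ ⨾ Γ ⇒ C → ⊢ ζ′ ⨾ Γ ⇒ C
permute ζ↭ζ′ = conv (ζ↭ζ′ ⨾ ≈*-refl)

-- Contraction leaves a copy of []⁻¹ B alone in a bracket, which []⁻¹L opens:
-- the stoup formula []⁻¹ B is an inexhaustible supply of B's.
unlock : ∀ {ζ Γ B C} → []⁻¹ B ∈ ζ → ⊢ ζ ⨾ fm B ∷ Γ ⇒ C → ⊢ ζ ⨾ Γ ⇒ C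
unlock {ζ} {Γ} {B} {C} m d with ∈-∃++ m
... | ζ₁ , ζ₂ , refl =
  permute (↭-sym toEnd)
    (!C □ {ζ₁ ++ ζ₂} {[ []⁻¹ B ]} {[]} {[]} {Γ} (λ ())
      (permute toEnd
        (!P (inside ζ [] □ Γ) {[]} {[]} {[]}
          ([]⁻¹L □ {ζ} {[]} {Γ} d))))
  where
  toEnd : ζ₁ ++ [ []⁻¹ B ] ++ ζ₂ ↭ (ζ₁ ++ ζ₂) ++ [ []⁻¹ B ]
  toEnd = ↭-trans (shift ([]⁻¹ B) ζ₁ ζ₂) (∷↭∷ʳ ([]⁻¹ B) (ζ₁ ++ ζ₂))

-- The second formula disposes of the first.
supply : Formula → Stoup
supply B = []⁻¹ B ∷ 𝟏 / ! ([]⁻¹ B) ∷ []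

supplies : List Formula → Stoup
supplies = concatMap supply

∈-supplies : ∀ {B Bs} → B ∈ Bs → []⁻¹ B ∈ supplies Bs
∈-supplies {Bs = Bs} m = ∈-concatMap⁺ supply (Any.map (λ { refl → here refl }) m)

-- The two formulae of a supply annihilate: the second moves into the sequence, its argument
-- `! ([]⁻¹ B)` is derived by `!R` from the first alone, and the remaining `𝟏` disappears by `𝟏L`.
weaken : ∀ Bs {Γ C} → ⊢ [] ⨾ Γ ⇒ C → ⊢ supplies Bs ⨾ Γ ⇒ C
weaken []       d = d
weaken (B ∷ Bs) {Γ} d =
  permute (prep _ (↭-sym (∷↭∷ʳ (𝟏 / ! ([]⁻¹ B)) (supplies Bs))))
    (!P □ {[]⁻¹ B ∷ supplies Bs} {[]} {Γ}
      (/L □ {[ []⁻¹ B ]} {supplies Bs} {[]} {[]} {Γ}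
        (!R (!P □ {[]} {[]} {[]} ax))
        (𝟏L □ {supplies Bs} {[]} {Γ} (weaken Bs d))))

-- Word rewriting within the calculus.

infix 4 _▹_⟶_▹_

record Rule (L : Set) : Set where
  constructor _▹_⟶_▹_
  field
    prefix suffix prefix′ suffix′ : List L

module Rewriting {L : Set} (code : L → ℕ) (code-injective : ∀ {a b} → code a ≡ code b → a ≡ b) where

  s : Formula
  s = var 0

  letter : L → Formula
  letter a = var (suc (code a))

  letters : List L → List TreeTerm
  letters = map (λ a → fm (letter a))

  product : List L → Formula
  product = foldr (λ a A → letter a · A) 𝟏

  -- Derivations are read upwards: if s follows from u′ X v′, it follows from u X v.
  ruleFormula : Rule L → Formula
  ruleFormula (u ▹ v ⟶ u′ ▹ v′) = s / (product u · (product u′ ∖ (s / product v′)) · product v)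

  stopFormula : L → Formula
  stopFormula a = s / letter a

  letters-++ : ∀ u v → letters (u ++ v) ≡ letters u ++ letters v
  letters-++ = map-++ _

  productL : ∀ w {ζ Δ₁ Δ₂ C} → ⊢ ζ ⨾ Δ₁ ++ letters w ++ Δ₂ ⇒ C → ⊢ ζ ⨾ Δ₁ ++ fm (product w) ∷ Δ₂ ⇒ C
  productL []      {Δ₁ = Δ₁} d = 𝟏L □ {Δ₁ = Δ₁} d
  productL (a ∷ w) {ζ} {Δ₁} {Δ₂} {C} d =
    ·L □ {Δ₁ = Δ₁} (subst (λ Γ → ⊢ ζ ⨾ Γ ⇒ C) (∷ʳ-++ Δ₁ _ _)
      (productL w {Δ₁ = Δ₁ ∷ʳ _} (subst (λ Γ → ⊢ ζ ⨾ Γ ⇒ C) (sym (∷ʳ-++ Δ₁ _ _)) d)))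

  productR : ∀ w → ⊢ [] ⨾ letters w ⇒ product w
  productR []      = 𝟏R
  productR (a ∷ w) = ·R ax (productR w)

  rewriteStep : ∀ r {ζ} X → let open Rule r in []⁻¹ ruleFormula r ∈ ζ →
    ⊢ ζ ⨾ letters (prefix′ ++ X ++ suffix′) ⇒ s → ⊢ ζ ⨾ letters (prefix ++ X ++ suffix) ⇒ s
  rewriteStep (u ▹ v ⟶ u′ ▹ v′) {ζ} X m d =
    unlock m
      (subst₂ (λ ζ′ Γ → ⊢ ζ′ ⨾ fm (ruleFormula (u ▹ v ⟶ u′ ▹ v′)) ∷ Γ ⇒ s)
        (++-identityʳ ζ) (++-identityʳ _)
        -- The whole stoup goes to the left premise, since `ax` allows none, and from there to
        -- `rest`, where the rewriting continues.
        (/L □ {ζ} {[]} {letters (u ++ X ++ v)} {[]} {[]}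
          (subst₂ (λ ζ′ Γ → ⊢ ζ′ ⨾ Γ ⇒ product u · (product u′ ∖ (s / product v′)) · product v)
            (++-identityʳ ζ)
            (sym (trans (letters-++ u (X ++ v)) (cong (letters u ++_) (letters-++ X v))))
            (·R (productR u) (·R rest (productR v))))
          ax))
    where
    rest : ⊢ ζ ⨾ letters X ⇒ product u′ ∖ (s / product v′)
    rest = ∖R (/R (productL u′ {Δ₁ = []}
      (subst (λ Γ → ⊢ ζ ⨾ Γ ⇒ s) (++-assoc (letters u′) (letters X) _)
        (productL v′ {Δ₁ = letters u′ ++ letters X} {Δ₂ = []}
          (subst (λ Γ → ⊢ ζ ⨾ Γ ⇒ s) eq d)))))
      where
      open ≡-Reasoning
      eq : letters (u′ ++ X ++ v′) ≡ (letters u′ ++ letters X) ++ letters v′ ++ []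
      eq = begin
        letters (u′ ++ X ++ v′)                         ≡⟨ letters-++ u′ (X ++ v′) ⟩
        letters u′ ++ letters (X ++ v′)                 ≡⟨ cong (letters u′ ++_) (letters-++ X v′) ⟩
        letters u′ ++ letters X ++ letters v′           ≡⟨ ++-assoc (letters u′) (letters X) (letters v′) ⟨
        (letters u′ ++ letters X) ++ letters v′         ≡⟨ cong ((letters u′ ++ letters X) ++_) (++-identityʳ (letters v′)) ⟨
        (letters u′ ++ letters X) ++ letters v′ ++ []   ∎

  -- After one use of the stop formula only axioms remain, whose stoups are empty; so all supplies
  -- are discarded at this point.
  stopDerivable : ∀ {a} Bs → stopFormula a ∈ Bs → ⊢ supplies Bs ⨾ letters [ a ] ⇒ s
  stopDerivable Bs m = unlock (∈-supplies m) (weaken Bs (/L □ {[]} {[]} {_} {[]} {[]} ax ax))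

  module Model (Good : Pred (List L) 0ℓ) where

    V : ℕ → Pred (List L) 0ℓ
    V zero      = Good
    V (suc n) w = Σ[ a ∈ L ] code a ≡ n × w ≡ [ a ]

    open Semantics V

    -- Goodness passes from the rewritten word back to the original one, as derivability does.
    Preserves : Rule L → Set
    Preserves (u ▹ v ⟶ u′ ▹ v′) = ∀ X → Good (u′ ++ X ++ v′) → Good (u ++ X ++ v)

    ⟦letter⟧⁻ : ∀ {a w} → ⟦ letter a ⟧ w → w ≡ [ a ]
    ⟦letter⟧⁻ (b , e , refl) = cong [_] (code-injective e)

    ⟦product⟧⁺ : ∀ w → ⟦ product w ⟧ w
    ⟦product⟧⁺ []      = refl
    ⟦product⟧⁺ (a ∷ w) = [ a ] , w , refl , (a , refl , refl) , ⟦product⟧⁺ w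

    ⟦product⟧⁻ : ∀ w {w′} → ⟦ product w ⟧ w′ → w′ ≡ w
    ⟦product⟧⁻ []      p = p
    ⟦product⟧⁻ (a ∷ w) (_ , _ , refl , p , q) = cong₂ _++_ (⟦letter⟧⁻ p) (⟦product⟧⁻ w q)

    -- A product of letters holds of exactly one word, so the argument of the rule formula splits as
    -- `u`, `X`, `v`; its middle factor, applied to `u′` and `v′`, makes the rewritten word good.
    valid-rule : ∀ r → Preserves r → Valid (ruleFormula r)
    valid-rule (u ▹ v ⟶ u′ ▹ v′) h (_ , _ , refl , p , (X , _ , refl , f , q))
      with ⟦product⟧⁻ u p | ⟦product⟧⁻ v q
    ... | refl | refl =
      h X (subst Good (++-assoc u′ X v′) (f (⟦product⟧⁺ u′) (⟦product⟧⁺ v′)))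

    valid-stop : ∀ {a} → Good [ a ] → Valid (stopFormula a)
    valid-stop {a} g p = subst Good (sym (⟦letter⟧⁻ p)) g

    valid-supplies : ∀ {Bs} → All Valid Bs → All Valid (supplies Bs)
    valid-supplies []       = []
    -- `proj₁` validates the disposing formula: `! ([]⁻¹ B)` holds of the empty word at most.
    valid-supplies (p ∷ ps) = p ∷ proj₁ ∷ valid-supplies ps

    derivable⇒good : ∀ {Bs} a → All Valid Bs → ⊢ supplies Bs ⨾ letters [ a ] ⇒ s → Good [ a ]
    derivable⇒good a ps d =
      sound d (valid-supplies ps , single (a , refl , refl))

-- Finite alphabets and their numbering.

module Enumerated {A : Set} {as : List A} (complete : ∀ a → a ∈ as) where

  abstract
    code : A → ℕ
    code a = toℕ (Any.index (complete a))

    code-injective : ∀ {a b} → code a ≡ code b → a ≡ b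
    code-injective {a} {b} e =
      trans (lookup-index (complete a))
        (trans (cong (lookup as) (toℕ-injective e)) (sym (lookup-index (complete b))))

++-assoc₃ : ∀ {A : Set} (u v w {z} : List A) → (u ++ v ++ w) ++ z ≡ u ++ v ++ w ++ z
++-assoc₃ u v w = trans (++-assoc u (v ++ w) _) (cong (u ++_) (++-assoc v w _))

symbols : List Symbol
symbols = x′ ∷ stroke′ ∷ 𝟏′ ∷ ∖′ ∷ /′ ∷ ·′ ∷ ⟨⟩′ ∷ []⁻¹′ ∷ !′ ∷ open′ ∷ close′ ∷ semicolon′ ∷ arrow′ ∷ []

∈-symbols : ∀ σ → σ ∈ symbols
∈-symbols x′         = ∈-lookup {xs = symbols} (# 0)
∈-symbols stroke′    = ∈-lookup {xs = symbols} (# 1)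
∈-symbols 𝟏′         = ∈-lookup {xs = symbols} (# 2)
∈-symbols ∖′         = ∈-lookup {xs = symbols} (# 3)
∈-symbols /′         = ∈-lookup {xs = symbols} (# 4)
∈-symbols ·′         = ∈-lookup {xs = symbols} (# 5)
∈-symbols ⟨⟩′        = ∈-lookup {xs = symbols} (# 6)
∈-symbols []⁻¹′      = ∈-lookup {xs = symbols} (# 7)
∈-symbols !′         = ∈-lookup {xs = symbols} (# 8)
∈-symbols open′      = ∈-lookup {xs = symbols} (# 9)
∈-symbols close′     = ∈-lookup {xs = symbols} (# 10)
∈-symbols semicolon′ = ∈-lookup {xs = symbols} (# 11)
∈-symbols arrow′     = ∈-lookup {xs = symbols} (# 12)

cells : ∀ k → List (Cell k)
cells k = blank ∷ map input symbols ++ map aux (allFin k)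

∈-cells : ∀ {k} (c : Cell k) → c ∈ cells k
∈-cells blank     = here refl
∈-cells (input σ) = there (∈-++⁺ˡ (∈-map⁺ input (∈-symbols σ)))
∈-cells (aux i)   = there (∈-++⁺ʳ (map input symbols) (∈-map⁺ aux (∈-allFin i)))

-- The passes over the quotation, in reverse chronological order.
data Mode : Set where
  first second third : Mode

modes : List Mode
modes = first ∷ second ∷ third ∷ []

∈-modes : ∀ m → m ∈ modes
∈-modes first  = here refl
∈-modes second = there (here refl)
∈-modes third  = there (there (here refl))

deterministic : ∀ M {q t} → HaltsFrom M true q t → ¬ HaltsFrom M false q t
deterministic M (stop e)   (stop e′)    with () ← trans (sym e) e′
deterministic M (stop e)   (step e′ _)  with () ← trans (sym e) e′
deterministic M (step e _) (stop e′)    with () ← trans (sym e) e′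
deterministic M (step e h) (step e′ h′) with refl ← trans (sym e) e′ = deterministic M h h′

-- Alphabet, rules and the self-referential sequent.

module Diagonal (M : TuringMachine) where
  open TuringMachine M

  -- `launch` is the initial word, `load` calls for the quotation, `clear` erases the word after a
  -- rejection, and `end` marks the right end of the tape.
  data Letter : Set where
    launch load clear end : Letter
    mode   : Mode → Letter
    quoted : Symbol → Letter
    cell   : Cell #aux → Letter
    state  : Fin #states → Letter

  alphabet : List Letter
  alphabet = launch ∷ load ∷ clear ∷ end ∷ map mode modes ++ map quoted symbols ++
             map cell (cells #aux) ++ map state (allFin #states)

  ∈-alphabet : ∀ a → a ∈ alphabet
  ∈-alphabet launch     = here refl
  ∈-alphabet load       = there (here refl)
  ∈-alphabet clear      = there (there (here refl))
  ∈-alphabet end        = there (there (there (here refl)))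
  ∈-alphabet (mode m)   = ∈-++⁺ʳ (launch ∷ load ∷ clear ∷ end ∷ []) (∈-++⁺ˡ (∈-map⁺ mode (∈-modes m)))
  ∈-alphabet (quoted σ) = ∈-++⁺ʳ (launch ∷ load ∷ clear ∷ end ∷ map mode modes)
    (∈-++⁺ˡ (∈-map⁺ quoted (∈-symbols σ)))
  ∈-alphabet (cell c)   = ∈-++⁺ʳ (launch ∷ load ∷ clear ∷ end ∷ map mode modes)
    (∈-++⁺ʳ (map quoted symbols) (∈-++⁺ˡ (∈-map⁺ cell (∈-cells c))))
  ∈-alphabet (state q)  = ∈-++⁺ʳ (launch ∷ load ∷ clear ∷ end ∷ map mode modes)
    (∈-++⁺ʳ (map quoted symbols) (∈-++⁺ʳ (map cell (cells #aux)) (∈-map⁺ state (∈-allFin q))))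

  open Enumerated ∈-alphabet
  open Rewriting code code-injective

  -- These constants are read off from the shape of sequent: see encode-recite and encode-sequent.
  inProduct : Symbol → Word
  inProduct σ = ·′ ∷ encodeFormula (letter (quoted σ))

  preamble : Word
  preamble = []⁻¹′ ∷ /′ ∷ encodeFormula s ++ ·′ ∷ encodeFormula (product [ load ]) ++
             ·′ ∷ ∖′ ∷ 𝟏′ ∷ /′ ∷ encodeFormula s

  -- The encoding of the sequent contains the quotation three times: as factors of a product in both
  -- occurrences of `recite`, then literally.
  translate : Mode → Symbol → Word
  translate first  σ = inProduct σ
  translate second σ = inProduct σ
  translate third  σ = [ σ ]

  -- The two units end the product of quoted letters and render the empty suffix of `recite`; in
  -- `second`, the next three symbols open the formula disposing of `recite`.
  prepend : Mode → Word
  prepend first  = preamble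
  prepend second = 𝟏′ ∷ 𝟏′ ∷ /′ ∷ 𝟏′ ∷ !′ ∷ preamble
  prepend third  = 𝟏′ ∷ 𝟏′ ∷ []

  ending : Word
  ending = semicolon′ ∷ (encodeFormula (letter launch) ++ []) ++ arrow′ ∷ encodeFormula s

  onTape : Word → List Letter
  onTape = map (λ σ → cell (input σ))

  next : Mode → List Letter
  next first  = [ state start ]
  next second = load ∷ mode first ∷ []
  next third  = load ∷ mode second ∷ []

  boundary : Maybe (Cell #aux) → Letter
  boundary nothing  = end
  boundary (just c) = cell c

  -- The last argument is the neighbour to which the head moves, at the end of the word for `left`
  -- and in third place for `right`. An `end` found there means that the visited tape stops, and a
  -- blank is supplied.
  perform : Action #states #aux → Fin #states → Cell #aux → Maybe (Cell #aux) → Rule Letter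
  -- An accepting halt gets a rule that changes nothing, hence no way to `clear`.
  perform (halt true)      q c b        = [] ▹ [] ⟶ [] ▹ []
  perform (halt false)     q c b        = state q ∷ cell c ∷ [] ▹ [] ⟶ [ clear ] ▹ []
  perform (go q′ c′ left)  q c nothing  =
    state q ∷ cell c ∷ [] ▹ [ end ] ⟶ state q′ ∷ cell blank ∷ cell c′ ∷ [] ▹ [ end ]
  perform (go q′ c′ left)  q c (just d) =
    state q ∷ cell c ∷ [] ▹ [ cell d ] ⟶ state q′ ∷ cell d ∷ cell c′ ∷ [] ▹ []
  perform (go q′ c′ right) q c nothing  =
    state q ∷ cell c ∷ end ∷ [] ▹ [] ⟶ state q′ ∷ cell blank ∷ end ∷ [] ▹ [ cell c′ ]
  perform (go q′ c′ right) q c (just d) =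
    state q ∷ cell c ∷ cell d ∷ [] ▹ [] ⟶ state q′ ∷ cell d ∷ [] ▹ [ cell c′ ]

  transition : Fin #states → Cell #aux → Maybe (Cell #aux) → Rule Letter
  transition q c = perform (δ q c) q c

  initiate : Rule Letter
  initiate = [ launch ] ▹ [] ⟶ load ∷ mode third ∷ onTape ending ++ [ end ] ▹ []

  -- Quoted symbols are taken from the last one backwards, and their translations are put in front
  -- of the text already written.
  copy : Mode → Symbol → Rule Letter
  copy m σ = [ mode m ] ▹ [ quoted σ ] ⟶ mode m ∷ onTape (translate m σ) ▹ []

  -- An `end` in last position shows that the quotation is used up.
  close : Mode → Rule Letter
  close m = [ mode m ] ▹ [ end ] ⟶ next m ++ onTape (prepend m) ▹ [ end ]

  erase : Maybe (Cell #aux) → Rule Letter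
  erase b = clear ∷ boundary b ∷ [] ▹ [] ⟶ [ clear ] ▹ []

  boundaries : List (Maybe (Cell #aux))
  boundaries = nothing ∷ map just (cells #aux)

  ∈-boundaries : ∀ b → b ∈ boundaries
  ∈-boundaries nothing  = here refl
  ∈-boundaries (just c) = there (∈-map⁺ just (∈-cells c))

  transitions copies closes erasures rules : List (Rule Letter)
  transitions = concatMap (λ q → cartesianProductWith (transition q) (cells #aux) boundaries) (allFin #states)
  copies      = cartesianProductWith copy modes symbols
  closes      = map close modes
  erasures    = map erase boundaries
  rules       = initiate ∷ transitions ++ copies ++ closes ++ erasures

  core : List Formula
  core = stopFormula clear ∷ map ruleFormula rules

  quotation : Word
  quotation = encodeStoup (supplies core)

  -- No circularity arises: `quotation` encodes `core`, whose rules do not mention the quotation.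
  recite : Rule Letter
  recite = [ load ] ▹ [] ⟶ [] ▹ map quoted quotation

  program : List Formula
  program = ruleFormula recite ∷ core

  sequent : Sequent
  sequent = supplies program ⨾ letters [ launch ] ⇒ s

  translated : Mode → Word → Word
  translated m = concatMap (translate m)

  -- The input on which `M` will start if pass `m` has used up the quotation with text `w` written:
  -- the outstanding passes add the rest in front.
  eventual : Mode → Word → Word
  eventual first  w = preamble ++ w
  eventual second w = preamble ++ translated first quotation ++ prepend second ++ w
  eventual third  w = preamble ++ translated first quotation ++ prepend second ++
                      translated second quotation ++ prepend third ++ w

  -- The text written by the passes is the encoding of the sequent.

  encode-product : ∀ w → encodeFormula (product (map quoted w)) ≡ concatMap inProduct w ++ [ 𝟏′ ]
  encode-product []      = refl
  encode-product (σ ∷ w) = cong (·′ ∷_)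
    (trans (cong (encodeFormula (letter (quoted σ)) ++_) (encode-product w))
      (sym (++-assoc (encodeFormula (letter (quoted σ))) (concatMap inProduct w) _)))

  encode-recite : encodeFormula ([]⁻¹ ruleFormula recite) ≡
                  preamble ++ concatMap inProduct quotation ++ prepend third
  encode-recite = cong (λ w → []⁻¹′ ∷ /′ ∷ x′ ∷ ·′ ∷ w) (begin
    l ++ ·′ ∷ (∖′ ∷ 𝟏′ ∷ /′ ∷ x′ ∷ encodeFormula (product (map quoted quotation))) ++ [ 𝟏′ ]
      ≡⟨ cong (λ w → l ++ ·′ ∷ (∖′ ∷ 𝟏′ ∷ /′ ∷ x′ ∷ w) ++ [ 𝟏′ ]) (encode-product quotation) ⟩
    l ++ ·′ ∷ (∖′ ∷ 𝟏′ ∷ /′ ∷ x′ ∷ concatMap inProduct quotation ++ [ 𝟏′ ]) ++ [ 𝟏′ ]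
      ≡⟨ cong (λ w → l ++ ·′ ∷ ∖′ ∷ 𝟏′ ∷ /′ ∷ x′ ∷ w) (++-assoc (concatMap inProduct quotation) _ _) ⟩
    l ++ (·′ ∷ ∖′ ∷ 𝟏′ ∷ /′ ∷ x′ ∷ []) ++ concatMap inProduct quotation ++ prepend third
      ≡⟨ ++-assoc l _ _ ⟨
    (l ++ ·′ ∷ ∖′ ∷ 𝟏′ ∷ /′ ∷ x′ ∷ []) ++ concatMap inProduct quotation ++ prepend third ∎)
    where
    open ≡-Reasoning
    l : Word
    l = encodeFormula (product [ load ])

  -- This closes the quine: the input assembled during the derivation encodes the very sequent being
  -- derived.
  encode-sequent : encode sequent ≡ eventual third (translated third quotation ++ ending)
  encode-sequent = begin
    ((r ++ (/′ ∷ 𝟏′ ∷ !′ ∷ r) ++ q) ++ semicolon′ ∷ e) ++ arrow′ ∷ x′ ∷ []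
      ≡⟨ ++-assoc (r ++ (/′ ∷ 𝟏′ ∷ !′ ∷ r) ++ q) _ _ ⟩
    (r ++ (/′ ∷ 𝟏′ ∷ !′ ∷ r) ++ q) ++ ending
      ≡⟨ ++-assoc r _ _ ⟩
    r ++ /′ ∷ 𝟏′ ∷ !′ ∷ (r ++ q) ++ ending
      ≡⟨ cong (λ w → r ++ /′ ∷ 𝟏′ ∷ !′ ∷ w) (++-assoc r q ending) ⟩
    r ++ /′ ∷ 𝟏′ ∷ !′ ∷ r ++ q ++ ending
      ≡⟨ cong (λ r → r ++ /′ ∷ 𝟏′ ∷ !′ ∷ r ++ q ++ ending) encode-recite ⟩
    (p ++ h ++ t) ++ /′ ∷ 𝟏′ ∷ !′ ∷ (p ++ h ++ t) ++ q ++ ending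
      ≡⟨ ++-assoc₃ p h t ⟩
    p ++ h ++ t ++ /′ ∷ 𝟏′ ∷ !′ ∷ (p ++ h ++ t) ++ q ++ ending
      ≡⟨ cong (λ w → p ++ h ++ t ++ /′ ∷ 𝟏′ ∷ !′ ∷ w) (++-assoc₃ p h t) ⟩
    p ++ h ++ prepend second ++ h ++ t ++ q ++ ending
      ≡⟨ cong (λ w → p ++ h ++ prepend second ++ h ++ t ++ w ++ ending) (concatMap-pure q) ⟨
    eventual third (translated third quotation ++ ending) ∎
    where
    open ≡-Reasoning
    r p h t q e : Word
    r = encodeFormula ([]⁻¹ ruleFormula recite)
    p = preamble
    h = concatMap inProduct quotation
    t = prepend third
    q = quotation
    e = encodeFormula (letter launch) ++ []

  -- Configurations and the runs they lead to.

  data Phase : Set where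
    launching : Phase
    loading   : Mode → Word → Phase
    copying   : Mode → Word → Word → Phase
    running   : Fin #states → Tape #aux → Phase

  -- Configurations are cut open at the head: the cells to its left wrap around to the right end.
  word : Phase → List Letter
  word launching                = [ launch ]
  word (loading m w)            = load ∷ mode m ∷ onTape w ++ [ end ]
  word (copying m w v)          = mode m ∷ onTape w ++ end ∷ map quoted v
  word (running q (tape l c r)) = state q ∷ cell c ∷ map cell r ++ end ∷ map cell (reverse l)

  -- Before `M` runs, this speaks of the input that the remaining passes are bound to produce.
  Outcome : Phase → Set
  Outcome launching       = Rejects M (encode sequent)
  Outcome (loading m w)   = Rejects M (eventual m (translated m quotation ++ w))
  Outcome (copying m w v) = Rejects M (eventual m (translated m v ++ w))
  Outcome (running q t)   = HaltsFrom M false q t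

  onTape-++ : ∀ u v → onTape (u ++ v) ≡ onTape u ++ onTape v
  onTape-++ = map-++ _

  onTape-++₂ : ∀ u v z → onTape u ++ onTape v ++ z ≡ onTape (u ++ v) ++ z
  onTape-++₂ u v z = trans (sym (++-assoc (onTape u) _ z)) (cong (_++ z) (sym (onTape-++ u v)))

  quoted-∷ʳ : ∀ w v σ → onTape w ++ end ∷ map quoted (v ∷ʳ σ) ≡ (onTape w ++ end ∷ map quoted v) ∷ʳ quoted σ
  quoted-∷ʳ w v σ = trans (cong (λ z → onTape w ++ end ∷ z) (map-++ quoted v [ σ ]))
                          (sym (++-assoc (onTape w) (end ∷ map quoted v) _))

  left-∷ : ∀ r c l → map cell r ++ end ∷ map cell (reverse (c ∷ l)) ≡
                     (map cell r ++ end ∷ map cell (reverse l)) ∷ʳ cell c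
  left-∷ r c l = trans
    (cong (λ z → map cell r ++ end ∷ z)
      (trans (cong (map cell) (unfold-reverse c l)) (map-++ cell (reverse l) [ c ])))
    (sym (++-assoc (map cell r) (end ∷ map cell (reverse l)) _))

  start-word : ∀ w → state start ∷ onTape preamble ++ onTape w ++ [ end ] ≡
                     word (running start (initialTape (preamble ++ w)))
  -- `preamble` is nonempty, so its first symbol is scanned and no cell lies to the left of the
  -- head.
  start-word w = cong (state start ∷_) (trans (onTape-++₂ preamble w _)
    (cong (λ z → z ++ [ end ]) (map-∘ (preamble ++ w))))

  translated-∷ʳ : ∀ m v σ w → translated m (v ∷ʳ σ) ++ w ≡ translated m v ++ translate m σ ++ w
  translated-∷ʳ m v σ w = trans (cong (_++ w) (concatMap-++ (translate m) v [ σ ]))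
    (trans (++-assoc (translated m v) _ w)
      (cong (λ z → translated m v ++ z ++ w) (++-identityʳ (translate m σ))))

  -- From rejection to derivability.

  ∈-transition : ∀ {α} q c b → δ q c ≡ α → perform α q c b ∈ rules
  ∈-transition q c b refl = there (∈-++⁺ˡ
    (∈-concatMap⁺ (λ q → cartesianProductWith (transition q) (cells #aux) boundaries)
      (Any.map (λ { refl → ∈-cartesianProductWith⁺ (transition q) (∈-cells c) (∈-boundaries b) })
        (∈-allFin q))))

  ∈-copy : ∀ m σ → copy m σ ∈ rules
  ∈-copy m σ = there (∈-++⁺ʳ transitions (∈-++⁺ˡ
    (∈-cartesianProductWith⁺ copy (∈-modes m) (∈-symbols σ))))

  ∈-close : ∀ m → close m ∈ rules
  ∈-close m = there (∈-++⁺ʳ transitions (∈-++⁺ʳ copies (∈-++⁺ˡ (∈-map⁺ close (∈-modes m)))))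

  ∈-erase : ∀ b → erase b ∈ rules
  ∈-erase b = there (∈-++⁺ʳ transitions (∈-++⁺ʳ copies (∈-++⁺ʳ closes
    (∈-map⁺ erase (∈-boundaries b)))))

  Provable : List Letter → Set
  Provable w = ⊢ supplies program ⨾ letters w ⇒ s

  apply : ∀ {r} → r ∈ rules → ∀ X → let open Rule r in
          Provable (prefix′ ++ X ++ suffix′) → Provable (prefix ++ X ++ suffix)
  apply {r} m X = rewriteStep r X (∈-supplies (there (there (∈-map⁺ ruleFormula m))))

  erase-cells : ∀ cs {w} → Provable (clear ∷ w) → Provable (clear ∷ map cell cs ++ w)
  erase-cells []       d = d
  erase-cells (c ∷ cs) {w} d = subst Provable (cong (λ z → clear ∷ cell c ∷ z) (++-identityʳ _))
    (apply (∈-erase (just c)) (map cell cs ++ w)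
      (subst Provable (cong (clear ∷_) (sym (++-identityʳ _))) (erase-cells cs d)))

  erase-end : ∀ {w} → Provable (clear ∷ w) → Provable (clear ∷ end ∷ w)
  erase-end d = subst Provable (cong (λ z → clear ∷ end ∷ z) (++-identityʳ _))
    (apply (∈-erase nothing) _ (subst Provable (cong (clear ∷_) (sym (++-identityʳ _))) d))

  stop-provable : Provable [ clear ]
  stop-provable = stopDerivable program (there (here refl))

  rejecting-provable : ∀ {q t} → HaltsFrom M false q t → Provable (word (running q t))
  rejecting-provable {q} {tape l c r} (stop e) =
    subst Provable (cong (λ z → state q ∷ cell c ∷ z) (++-identityʳ _))
      -- `nothing` is an arbitrary choice: the rule of a halt is the same for every neighbour.
      (apply (∈-transition q c nothing e) _
        (subst Provable (cong (clear ∷_) (sym (++-identityʳ _)))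
          (erase-cells r (erase-end (subst (λ z → Provable (clear ∷ z)) (++-identityʳ _)
            (erase-cells (reverse l) stop-provable))))))
  rejecting-provable {q} {tape [] c r} (step {q′} {c′} {left} e h) =
    apply (∈-transition q c nothing e) (map cell r) (rejecting-provable h)
  rejecting-provable {q} {tape (d ∷ l) c r} (step {q′} {c′} {left} e h) =
    subst Provable (cong (λ z → state q ∷ cell c ∷ z) (sym (left-∷ r d l)))
      (apply (∈-transition q c (just d) e) (map cell r ++ end ∷ map cell (reverse l))
        (subst Provable (cong (λ z → state q′ ∷ cell d ∷ cell c′ ∷ z) (sym (++-identityʳ _)))
          (rejecting-provable h)))
  rejecting-provable {q} {tape l c []} (step {q′} {c′} {right} e h) =
    subst Provable (cong (λ z → state q ∷ cell c ∷ end ∷ z) (++-identityʳ _))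
      (apply (∈-transition q c nothing e) (map cell (reverse l))
        (subst Provable (cong (λ z → state q′ ∷ cell blank ∷ z) (left-∷ [] c′ l))
          (rejecting-provable h)))
  rejecting-provable {q} {tape l c (d ∷ r)} (step {q′} {c′} {right} e h) =
    subst Provable (cong (λ z → state q ∷ cell c ∷ cell d ∷ z) (++-identityʳ _))
      (apply (∈-transition q c (just d) e) (map cell r ++ end ∷ map cell (reverse l))
        (subst Provable (cong (λ z → state q′ ∷ cell d ∷ z) (left-∷ r c′ l))
          (rejecting-provable h)))

  -- Induction from the right end of `v`, where `copy` takes its symbols.
  copy-provable : ∀ m {v} → Reverse v → ∀ w →
                  Provable (word (copying m (translated m v ++ w) [])) → Provable (word (copying m w v))
  copy-provable m []              w d = d
  copy-provable m (v ∶ rv ∶ʳ σ) w d =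
    subst (λ z → Provable (mode m ∷ z)) (sym (quoted-∷ʳ w v σ))
      (apply (∈-copy m σ) (onTape w ++ end ∷ map quoted v)
        (subst (λ z → Provable (mode m ∷ z))
          (trans (sym (onTape-++₂ (translate m σ) w _))
            (cong (onTape (translate m σ) ++_) (sym (++-identityʳ _))))
          (copy-provable m rv (translate m σ ++ w)
            (subst (λ z → Provable (word (copying m z []))) (translated-∷ʳ m v σ w) d))))

  load-provable : ∀ m {w} → Provable (word (copying m (translated m quotation ++ w) [])) →
                  Provable (word (loading m w))
  load-provable m {w} d = subst (λ z → Provable (load ∷ z)) (++-identityʳ _)
    (rewriteStep recite (mode m ∷ onTape w ++ [ end ]) (∈-supplies {Bs = program} (here refl))
      (subst (λ z → Provable (mode m ∷ z)) (sym (++-assoc (onTape w) _ _))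
        (copy-provable m (reverseView quotation) w d)))

  -- The passes are chained backwards from the run of `M`: each one relies on the pass that follows
  -- it in time.
  close-first : ∀ {w} → Rejects M (eventual first w) → Provable (word (copying first w []))
  close-first {w} h = apply (∈-close first) (onTape w)
    (subst Provable (sym (start-word w)) (rejecting-provable h))

  close-second : ∀ {w} → Rejects M (eventual second w) → Provable (word (copying second w []))
  close-second {w} h = apply (∈-close second) (onTape w)
    (subst (λ z → Provable (load ∷ mode first ∷ z)) (sym (onTape-++₂ (prepend second) w _))
      (load-provable first (close-first h)))

  close-third : ∀ {w} → Rejects M (eventual third w) → Provable (word (copying third w []))
  close-third {w} h = apply (∈-close third) (onTape w)
    (subst (λ z → Provable (load ∷ mode second ∷ z)) (sym (onTape-++₂ (prepend third) w _))
      (load-provable second (close-second h)))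

  rejected⇒derivable : Rejects M (encode sequent) → ⊢ sequent
  rejected⇒derivable h = apply {initiate} (here refl) []
    (subst (λ z → Provable (load ∷ mode third ∷ z)) (sym (++-identityʳ _))
      (load-provable third (close-third (subst (Rejects M) encode-sequent h))))

  -- From derivability to rejection.

  Good : Pred (List Letter) 0ℓ
  Good w = ∀ p → w ≡ word p → Outcome p

  open Model Good

  -- A word that is no configuration is good vacuously, and no configuration starts with `clear`.
  -- This validates the stop formula and the erasing rules.
  good-clear : ∀ {w} → Good (clear ∷ w)
  good-clear launching       ()
  good-clear (loading _ _)   ()
  good-clear (copying _ _ _) ()
  good-clear (running _ _)   ()

  good-launch : Outcome launching → Good [ launch ]
  good-launch h launching       _ = h
  good-launch h (loading _ _)   ()
  good-launch h (copying _ _ _) ()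
  good-launch h (running _ _)   ()

  good-loading : ∀ {z} → (∀ m w → z ≡ mode m ∷ onTape w ++ [ end ] → Outcome (loading m w)) → Good (load ∷ z)
  good-loading h launching       ()
  good-loading h (loading m w)   eq = h m w (∷-injectiveʳ eq)
  good-loading h (copying _ _ _) ()
  good-loading h (running _ _)   ()

  good-copying : ∀ {m z} → (∀ w v → z ≡ onTape w ++ end ∷ map quoted v → Outcome (copying m w v)) →
                 Good (mode m ∷ z)
  good-copying h launching       ()
  good-copying h (loading _ _)   ()
  good-copying h (copying m w v) eq with refl ← ∷-injectiveˡ eq = h w v (∷-injectiveʳ eq)
  good-copying h (running _ _)   ()

  good-running : ∀ {q c z} →
                 (∀ l r → z ≡ map cell r ++ end ∷ map cell (reverse l) → HaltsFrom M false q (tape l c r)) →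
                 Good (state q ∷ cell c ∷ z)
  good-running h launching       ()
  good-running h (loading _ _)   ()
  good-running h (copying _ _ _) ()
  good-running h (running q (tape l c r)) eq
    with refl ← ∷-injectiveˡ eq | refl ← ∷-injectiveˡ (∷-injectiveʳ eq) =
    h l r (∷-injectiveʳ (∷-injectiveʳ eq))

  -- As cells differ from `end`, the letter in the neighbour's place tells whether the visited tape
  -- continues there. The tapes that do not fit the rule are thus excluded, and for the others
  -- `step e` prolongs the run.
  preserves-perform : ∀ {α} q c b → δ q c ≡ α → Preserves (perform α q c b)
  preserves-perform {halt true}  q c b e X g = g
  preserves-perform {halt false} q c b e X g = good-running λ _ _ _ → stop e
  preserves-perform {go q′ c′ left} q c nothing e X g = good-running h
    where
    h : ∀ l r → X ∷ʳ end ≡ map cell r ++ end ∷ map cell (reverse l) → HaltsFrom M false q (tape l c r)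
    h [] r eq = step e (g (running q′ (tape [] blank (c′ ∷ r)))
      (cong (λ z → state q′ ∷ cell blank ∷ cell c′ ∷ z) eq))
    h (d ∷ l) r eq with () ← ∷ʳ-injectiveʳ X _ (trans eq (left-∷ r d l))
  preserves-perform {go q′ c′ left} q c (just d) e X g = good-running h
    where
    h : ∀ l r → X ∷ʳ cell d ≡ map cell r ++ end ∷ map cell (reverse l) → HaltsFrom M false q (tape l c r)
    h [] r eq with () ← ∷ʳ-injectiveʳ X (map cell r) eq
    h (d′ ∷ l) r eq with refl , refl ← ∷ʳ-injective X _ (trans eq (left-∷ r d′ l)) =
      step e (g (running q′ (tape l d (c′ ∷ r)))
        (cong (λ z → state q′ ∷ cell d ∷ cell c′ ∷ z) (++-identityʳ _)))
  preserves-perform {go q′ c′ right} q c nothing e X g = good-running h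
    where
    h : ∀ l r → end ∷ X ++ [] ≡ map cell r ++ end ∷ map cell (reverse l) → HaltsFrom M false q (tape l c r)
    h l [] eq with refl ← trans (sym (++-identityʳ X)) (∷-injectiveʳ eq) =
      step e (g (running q′ (tape (c′ ∷ l) blank []))
        (cong (λ z → state q′ ∷ cell blank ∷ z) (sym (left-∷ [] c′ l))))
    h l (_ ∷ _) ()
  preserves-perform {go q′ c′ right} q c (just d) e X g = good-running h
    where
    h : ∀ l r → cell d ∷ X ++ [] ≡ map cell r ++ end ∷ map cell (reverse l) → HaltsFrom M false q (tape l c r)
    h l [] ()
    h l (d′ ∷ r) eq
      with refl ← ∷-injectiveˡ eq | refl ← trans (sym (++-identityʳ X)) (∷-injectiveʳ eq) =
      step e (g (running q′ (tape (c′ ∷ l) d r))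
        (cong (λ z → state q′ ∷ cell d ∷ z) (sym (left-∷ r c′ l))))

  preserves-initiate : Preserves initiate
  preserves-initiate []      g = good-launch
    (subst (Rejects M) (sym encode-sequent)
      (g (loading third ending) (cong (λ z → load ∷ mode third ∷ z) (++-identityʳ _))))
  -- No configuration has further letters after `launch`.
  preserves-initiate (_ ∷ _) g launching       ()
  preserves-initiate (_ ∷ _) g (loading _ _)   ()
  preserves-initiate (_ ∷ _) g (copying _ _ _) ()
  preserves-initiate (_ ∷ _) g (running _ _)   ()

  preserves-copy : ∀ m σ → Preserves (copy m σ)
  preserves-copy m σ X g = good-copying h
    where
    h : ∀ w v → X ∷ʳ quoted σ ≡ onTape w ++ end ∷ map quoted v → Outcome (copying m w v)
    h w v eq with initLast v
    ... | [] with () ← ∷ʳ-injectiveʳ X (onTape w) eq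
    h w .(v ∷ʳ σ′) eq | v ∷ʳ′ σ′
      with refl , refl ← ∷ʳ-injective X _ (trans eq (quoted-∷ʳ w v σ′)) =
      subst (λ z → Rejects M (eventual m z)) (sym (translated-∷ʳ m v σ w))
        (g (copying m (translate m σ ++ w) v)
          (cong (mode m ∷_) (trans (cong (onTape (translate m σ) ++_) (++-identityʳ _))
            (onTape-++₂ (translate m σ) w _))))

  preserves-close : ∀ m → Preserves (close m)
  preserves-close m X g = good-copying h
    where
    advance : ∀ m w → Good ((next m ++ onTape (prepend m)) ++ onTape w ++ [ end ]) → Rejects M (eventual m w)
    advance first  w g = g (running start (initialTape (preamble ++ w))) (start-word w)
    advance second w g = g (loading first (prepend second ++ w))
      (cong (λ z → load ∷ mode first ∷ z) (onTape-++₂ (prepend second) w _))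
    advance third  w g = g (loading second (prepend third ++ w))
      (cong (λ z → load ∷ mode second ∷ z) (onTape-++₂ (prepend third) w _))

    h : ∀ w v → X ∷ʳ end ≡ onTape w ++ end ∷ map quoted v → Outcome (copying m w v)
    h w v eq with initLast v
    ... | [] with refl ← ∷ʳ-injectiveˡ X (onTape w) eq = advance m w g
    -- While symbols remain to be copied, the last letter is a quoted one and cannot be `end`.
    h w .(v ∷ʳ σ) eq | v ∷ʳ′ σ with () ← ∷ʳ-injectiveʳ X _ (trans eq (quoted-∷ʳ w v σ))

  preserves-recite : Preserves recite
  preserves-recite X g = good-loading λ m w eq → g (copying m w quotation)
    (trans (cong (_++ map quoted quotation) (trans (sym (++-identityʳ X)) eq))
      (cong (mode m ∷_) (++-assoc (onTape w) [ end ] _)))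

  preserves-rules : All Preserves rules
  preserves-rules = preserves-initiate ∷
    All.++⁺ (All.concat⁺ (All.map⁺ (universal
        (λ q → All.cartesianProductWith⁺ (setoid _) (setoid _) (transition q) (cells #aux) boundaries
          λ {c} {b} _ _ → preserves-perform q c b refl) (allFin #states))))
      (All.++⁺ (All.cartesianProductWith⁺ (setoid _) (setoid _) copy modes symbols λ {m} {σ} _ _ → preserves-copy m σ)
        (All.++⁺ (All.map⁺ {f = close} (universal preserves-close modes))
          (All.map⁺ {f = erase} (universal (λ b X _ → good-clear) boundaries))))

  derivable⇒rejected : ⊢ sequent → Rejects M (encode sequent)
  derivable⇒rejected d = derivable⇒good launch
    ((λ {v} → valid-rule recite preserves-recite {v}) ∷ (λ {v} → valid-stop good-clear {v}) ∷
      All.map⁺ (All.map (λ {r} h {v} → valid-rule r h {v}) preserves-rules))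
    d launching refl

theorem8 : ¬ AlgorithmicallyDecidable ⊢_
-- If `M` rejected the sequent, it would be derivable and so accepted too. Hence it is not rejected,
-- so it is not derivable, and `M` has to reject it after all.
theorem8 (M , decides) = unrejected (proj₂ (decides sequent) λ d → unrejected (derivable⇒rejected d))
  where
  open Diagonal M
  unrejected : ¬ Rejects M (encode sequent)
  unrejected h = deterministic M (proj₁ (decides sequent) (rejected⇒derivable h)) h
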